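{- Let $\{P_m\}_{m\ge 0}$ be the Padovan sequence. The pair $(n,x)=(4,5)$ is the only pair such that $n$ is a non-negative integer, $x$ is a Padovan number (that is, $x=P_m$ for some integer $m\ge 0$), and $n!+1=x^{2}$.
   Context: The Padovan sequence $\{P_m\}_{m\ge 0}$ is defined by $P_0=P_1=P_2=1$ and $P_{m+3}=P_{m+1}+P_m$ for all $m\ge 0$. Its first terms are $1,1,1,2,2,3,4,5,7,9,12,16,\ldots$. Uniqueness refers to the pair $(n,x)$, not to the index $m$. -}

module Defs where

open import Data.Nat.Base using (ℕ; suc; _+_)
open import Data.Product.Base using (∃-syntax)
open import Relation.Binary.PropositionalEquality.Core using (_≡_)

padovan : ℕ → ℕ
padovan 0 = 1
padovan 1 = 1
padovan 2 = 1
padovan (suc (suc (suc m))) = padovan (suc m) + padovan m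

IsPadovan : ℕ → Set
IsPadovan x = ∃[ m ] x ≡ padovan m

{-# OPTIONS --safe #-}
module Submission where

-- Suppose n ≥ 14.  Extended to negative indices, the Padovan sequence takes
-- the values ±1 at eleven indices between -26 and 2.  Modulo 35 it has period
-- 48, and P_m² ≡ 1 forces m to agree mod 48 with one of these indices, each of
-- which is a simple root modulo 7.  Hence, as in Hensel's lemma, 35·7^k ∣ P_m² - 1
-- forces m to agree with one of them mod 48·7^k.  So either P_m = 1, or
-- m ≥ 48·7^k - 26 and P_m is doubly exponential in k; but P_m² = n! + 1 with
-- k about n/7, and n! is much smaller.

open import Defs
open import Data.Nat.Base using (ℕ; zero; suc; _+_; _^_; _!)
open import Data.Product.Base using (_×_; _,_; ∃-syntax; proj₁; proj₂)
open import Data.Sum.Base using ([_,_]′)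
open import Function.Base using (id)
open import Function.Bundles using (_⇔_; mk⇔)
open import Relation.Binary.PropositionalEquality using (_≡_; _≢_; refl; sym; trans; cong; cong₂; subst; subst₂; module ≡-Reasoning)
open import Relation.Nullary using (¬_; ¬?; yes; no; contradiction; _×-dec_; _→-dec_)
open import Relation.Nullary.Decidable using (from-yes)
import Data.Nat.Base as ℕ
import Data.Nat.Properties as ℕ
import Data.Nat.DivMod as ℕ
import Data.Nat.Divisibility as ℕ
open import Algebra.Properties.CommutativeSemigroup ℕ.*-commutativeSemigroup using (x∙yz≈y∙xz)
open import Data.Nat.Primality using (prime?; euclidsLemma)
open import Data.Integer.Base as ℤ using (ℤ; +_; -[1+_]; 1ℤ; NonZero; ∣_∣)
import Data.Integer.Properties as ℤ
open import Data.Integer.Divisibility.Signed using (_∣_; divides; _∣?_; ∣-trans; ∣ᵤ⇒∣; ∣⇒∣ᵤ; ∣m∣n⇒∣m+n; ∣m∣n⇒∣m-n; ∣-refl; ∣m⇒∣m*n; ∣m+n∣n⇒∣m; *-cancelˡ-∣)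
open import Data.Integer.Tactic.RingSolver using (solve-∀)

-- Integer sequences satisfying the Padovan recurrence, and their shift by 48.

Recurrent : (ℕ → ℤ) → Set
Recurrent V = ∀ j → V (3 + j) ≡ V (1 + j) ℤ.+ V j

-- Carrying a window of three consecutive values avoids branching recursion, so values at literal
-- indices are cheap to compute.
run : ℤ → ℤ → ℤ → ℕ → ℤ
run a b c zero    = a
run a b c (suc i) = run b c (b ℤ.+ a) i

run-recurrent : ∀ a b c → Recurrent (run a b c)
run-recurrent a b c zero    = refl
run-recurrent a b c (suc i) = run-recurrent b c (b ℤ.+ a) i

run-unique : ∀ V → Recurrent V → ∀ i j →
             V (i + j) ≡ run (V j) (V (1 + j)) (V (2 + j)) i
run-unique V R zero    j = refl
run-unique V R (suc i) j = begin
  V (suc i + j)                                  ≡⟨ cong V (sym (ℕ.+-suc i j)) ⟩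
  V (i + suc j)                                  ≡⟨ run-unique V R i (suc j) ⟩
  run (V (1 + j)) (V (2 + j)) (V (3 + j)) i      ≡⟨ cong (λ v → run (V (1 + j)) (V (2 + j)) v i) (R j) ⟩
  run (V j) (V (1 + j)) (V (2 + j)) (suc i)      ∎
  where open ≡-Reasoning

-- The solutions form a free module of rank 3 on their initial values. At a literal index the three
-- coefficients come from evaluation.
run-linear : ∀ a b c i →
  run a b c i ≡ run (+ 1) (+ 0) (+ 0) i ℤ.* a ℤ.+ run (+ 0) (+ 1) (+ 0) i ℤ.* b ℤ.+ run (+ 0) (+ 0) (+ 1) i ℤ.* c
run-linear a b c zero = identity a b c
  where
  identity : ∀ a b c → a ≡ + 1 ℤ.* a ℤ.+ + 0 ℤ.* b ℤ.+ + 0 ℤ.* c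
  identity = solve-∀
run-linear a b c (suc i) = trans (run-linear b c (b ℤ.+ a) i)
  -- The windows (1,0,0) and (0,0,1) move to basis windows, but (0,1,0) moves to (1,0,1), which the
  -- induction hypothesis has to expand once more.
  (trans (identity a b c α β γ) (cong (λ v → γ ℤ.* a ℤ.+ v ℤ.* b ℤ.+ β ℤ.* c) (sym (run-linear (+ 1) (+ 0) (+ 1) i))))
  where
  α = run (+ 1) (+ 0) (+ 0) i
  β = run (+ 0) (+ 1) (+ 0) i
  γ = run (+ 0) (+ 0) (+ 1) i
  identity : ∀ a b c α β γ → α ℤ.* b ℤ.+ β ℤ.* c ℤ.+ γ ℤ.* (b ℤ.+ a)
    ≡ γ ℤ.* a ℤ.+ (α ℤ.* + 1 ℤ.+ β ℤ.* + 0 ℤ.+ γ ℤ.* + 1) ℤ.* b ℤ.+ β ℤ.* c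
  identity = solve-∀

-- Modulo x³ = x + 1 one has x⁴⁸ = 1 + 35 (3680 + 6458 x + 4875 x²).
derivative : (ℕ → ℤ) → ℕ → ℤ
derivative V j = + 3680 ℤ.* V j ℤ.+ + 6458 ℤ.* V (1 + j) ℤ.+ + 4875 ℤ.* V (2 + j)

shift-by-48 : ∀ V → Recurrent V → ∀ j → V (j + 48) ≡ V j ℤ.+ + 35 ℤ.* derivative V j
shift-by-48 V R j = begin
  V (j + 48)                                     ≡⟨ cong V (ℕ.+-comm j 48) ⟩
  V (48 + j)                                     ≡⟨ run-unique V R 48 j ⟩
  run (V j) (V (1 + j)) (V (2 + j)) 48           ≡⟨ run-linear (V j) (V (1 + j)) (V (2 + j)) 48 ⟩
  -- The three basis solutions are evaluated at index 48; this is where the constants of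
  -- `derivative` come from.
  (1ℤ ℤ.+ + 35 ℤ.* + 3680) ℤ.* V j ℤ.+ + 35 ℤ.* + 6458 ℤ.* V (1 + j) ℤ.+ + 35 ℤ.* + 4875 ℤ.* V (2 + j)
                                                 ≡⟨ identity (+ 35) (+ 3680) (+ 6458) (+ 4875) (V j) (V (1 + j)) (V (2 + j)) ⟩
  V j ℤ.+ + 35 ℤ.* derivative V j                ∎
  where
  open ≡-Reasoning
  identity : ∀ d p q r a b c → (1ℤ ℤ.+ d ℤ.* p) ℤ.* a ℤ.+ d ℤ.* q ℤ.* b ℤ.+ d ℤ.* r ℤ.* c
    ≡ a ℤ.+ d ℤ.* (p ℤ.* a ℤ.+ q ℤ.* b ℤ.+ r ℤ.* c)
  identity = solve-∀

-- The sequence a·W is a difference of two solutions, hence a solution, and the nonzero factor a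
-- cancels.
quotient-recurrent : ∀ V W N a .{{_ : NonZero a}} → Recurrent V →
  (∀ j → V (j + N) ≡ V j ℤ.+ a ℤ.* W j) → Recurrent W
quotient-recurrent V W N a R eq j = ℤ.*-cancelˡ-≡ a _ _ (begin
  a ℤ.* W (3 + j)                                                  ≡⟨ difference (3 + j) ⟩
  V (3 + j + N) ℤ.- V (3 + j)                                      ≡⟨ cong₂ ℤ._-_ (R (j + N)) (R j) ⟩
  (V (1 + j + N) ℤ.+ V (j + N)) ℤ.- (V (1 + j) ℤ.+ V j)            ≡⟨ rearrange (V (1 + j + N)) (V (j + N)) (V (1 + j)) (V j) ⟩
  (V (1 + j + N) ℤ.- V (1 + j)) ℤ.+ (V (j + N) ℤ.- V j)            ≡⟨ cong₂ ℤ._+_ (sym (difference (1 + j))) (sym (difference j)) ⟩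
  a ℤ.* W (1 + j) ℤ.+ a ℤ.* W j                                    ≡⟨ sym (ℤ.*-distribˡ-+ a _ _) ⟩
  a ℤ.* (W (1 + j) ℤ.+ W j)                                        ∎)
  where
  open ≡-Reasoning
  rearrange : ∀ p q r s → (p ℤ.+ q) ℤ.- (r ℤ.+ s) ≡ (p ℤ.- r) ℤ.+ (q ℤ.- s)
  rearrange = solve-∀
  cancel : ∀ p q → q ≡ (p ℤ.+ q) ℤ.- p
  cancel = solve-∀
  difference : ∀ j → a ℤ.* W j ≡ V (j + N) ℤ.- V j
  difference j = trans (cancel (V j) _) (cong (ℤ._- V j) (sym (eq j)))

-- Shifts by 48·7^k and their first-order expansion.

-- D V is independent of N and a: only W modulo 7 matters for simple roots.
Shift : ((ℕ → ℤ) → ℕ → ℤ) → ℕ → ℤ → Set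
Shift D N a = ∀ V → Recurrent V → ∃[ W ] Recurrent W
  × (∀ j → V (j + N) ≡ V j ℤ.+ a ℤ.* W j)
  × (∀ j → + 7 ∣ W j ℤ.- D V j)

-- Newton's expansion v₇ = Σ C(7,i) aⁱ (Δ/a)ⁱ v₀, with the terms i ≥ 3 left as one remainder.
seventh-step : ∀ a (v w s u : ℕ → ℤ) →
  (∀ i → v (suc i) ≡ v i ℤ.+ a ℤ.* w i) →
  (∀ i → w (suc i) ≡ w i ℤ.+ a ℤ.* s i) →
  (∀ i → s (suc i) ≡ s i ℤ.+ a ℤ.* u i) →
  v 7 ≡ v 0 ℤ.+ a ℤ.* (+ 7 ℤ.* w 0 ℤ.+ a ℤ.* (+ 21 ℤ.* s 0 ℤ.+ a ℤ.*
    (+ 15 ℤ.* u 0 ℤ.+ + 10 ℤ.* u 1 ℤ.+ + 6 ℤ.* u 2 ℤ.+ + 3 ℤ.* u 3 ℤ.+ u 4)))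
seventh-step a v w s u v′ w′ s′ = begin
  v 7
    ≡⟨ v-sum ⟩
  v 0 ℤ.+ a ℤ.* (w 0 ℤ.+ w 1 ℤ.+ w 2 ℤ.+ w 3 ℤ.+ w 4 ℤ.+ w 5 ℤ.+ w 6)
    ≡⟨ cong (λ t → v 0 ℤ.+ a ℤ.* t) w-sum ⟩
  v 0 ℤ.+ a ℤ.* (+ 7 ℤ.* w 0 ℤ.+ a ℤ.* (+ 6 ℤ.* s 0 ℤ.+ + 5 ℤ.* s 1 ℤ.+ + 4 ℤ.* s 2 ℤ.+ + 3 ℤ.* s 3 ℤ.+ + 2 ℤ.* s 4 ℤ.+ s 5))
    ≡⟨ cong (λ t → v 0 ℤ.+ a ℤ.* (+ 7 ℤ.* w 0 ℤ.+ a ℤ.* t)) s-sum ⟩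
  _ ∎
  where
  open ≡-Reasoning
  v-identity : ∀ a v w₀ w₁ w₂ w₃ w₄ w₅ w₆ →
    v ℤ.+ a ℤ.* w₀ ℤ.+ a ℤ.* w₁ ℤ.+ a ℤ.* w₂ ℤ.+ a ℤ.* w₃ ℤ.+ a ℤ.* w₄ ℤ.+ a ℤ.* w₅ ℤ.+ a ℤ.* w₆
    ≡ v ℤ.+ a ℤ.* (w₀ ℤ.+ w₁ ℤ.+ w₂ ℤ.+ w₃ ℤ.+ w₄ ℤ.+ w₅ ℤ.+ w₆)
  v-identity = solve-∀
  v-sum : v 7 ≡ v 0 ℤ.+ a ℤ.* (w 0 ℤ.+ w 1 ℤ.+ w 2 ℤ.+ w 3 ℤ.+ w 4 ℤ.+ w 5 ℤ.+ w 6)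
  v-sum rewrite v′ 6 | v′ 5 | v′ 4 | v′ 3 | v′ 2 | v′ 1 | v′ 0 =
    v-identity a (v 0) (w 0) (w 1) (w 2) (w 3) (w 4) (w 5) (w 6)
  w-identity : ∀ a w s₀ s₁ s₂ s₃ s₄ s₅ →
    let w₁ = w  ℤ.+ a ℤ.* s₀
        w₂ = w₁ ℤ.+ a ℤ.* s₁
        w₃ = w₂ ℤ.+ a ℤ.* s₂
        w₄ = w₃ ℤ.+ a ℤ.* s₃
        w₅ = w₄ ℤ.+ a ℤ.* s₄
        w₆ = w₅ ℤ.+ a ℤ.* s₅
    in w ℤ.+ w₁ ℤ.+ w₂ ℤ.+ w₃ ℤ.+ w₄ ℤ.+ w₅ ℤ.+ w₆ ≡ + 7 ℤ.* w ℤ.+ a ℤ.*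
       (+ 6 ℤ.* s₀ ℤ.+ + 5 ℤ.* s₁ ℤ.+ + 4 ℤ.* s₂ ℤ.+ + 3 ℤ.* s₃ ℤ.+ + 2 ℤ.* s₄ ℤ.+ s₅)
  w-identity = solve-∀
  w-sum : w 0 ℤ.+ w 1 ℤ.+ w 2 ℤ.+ w 3 ℤ.+ w 4 ℤ.+ w 5 ℤ.+ w 6 ≡ + 7 ℤ.* w 0 ℤ.+ a ℤ.*
    (+ 6 ℤ.* s 0 ℤ.+ + 5 ℤ.* s 1 ℤ.+ + 4 ℤ.* s 2 ℤ.+ + 3 ℤ.* s 3 ℤ.+ + 2 ℤ.* s 4 ℤ.+ s 5)
  w-sum rewrite w′ 5 | w′ 4 | w′ 3 | w′ 2 | w′ 1 | w′ 0 =
    w-identity a (w 0) (s 0) (s 1) (s 2) (s 3) (s 4) (s 5)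
  s-identity : ∀ a s u₀ u₁ u₂ u₃ u₄ →
    let s₁ = s  ℤ.+ a ℤ.* u₀
        s₂ = s₁ ℤ.+ a ℤ.* u₁
        s₃ = s₂ ℤ.+ a ℤ.* u₂
        s₄ = s₃ ℤ.+ a ℤ.* u₃
        s₅ = s₄ ℤ.+ a ℤ.* u₄
    in + 6 ℤ.* s ℤ.+ + 5 ℤ.* s₁ ℤ.+ + 4 ℤ.* s₂ ℤ.+ + 3 ℤ.* s₃ ℤ.+ + 2 ℤ.* s₄ ℤ.+ s₅
       ≡ + 21 ℤ.* s ℤ.+ a ℤ.* (+ 15 ℤ.* u₀ ℤ.+ + 10 ℤ.* u₁ ℤ.+ + 6 ℤ.* u₂ ℤ.+ + 3 ℤ.* u₃ ℤ.+ u₄)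
  s-identity = solve-∀
  s-sum : + 6 ℤ.* s 0 ℤ.+ + 5 ℤ.* s 1 ℤ.+ + 4 ℤ.* s 2 ℤ.+ + 3 ℤ.* s 3 ℤ.+ + 2 ℤ.* s 4 ℤ.+ s 5
    ≡ + 21 ℤ.* s 0 ℤ.+ a ℤ.* (+ 15 ℤ.* u 0 ℤ.+ + 10 ℤ.* u 1 ℤ.+ + 6 ℤ.* u 2 ℤ.+ + 3 ℤ.* u 3 ℤ.+ u 4)
  s-sum rewrite s′ 4 | s′ 3 | s′ 2 | s′ 1 | s′ 0 =
    s-identity a (s 0) (u 0) (u 1) (u 2) (u 3) (u 4)

shift-48 : Shift derivative 48 (+ 35)
shift-48 V R = derivative V
  , quotient-recurrent V (derivative V) 48 (+ 35) R (shift-by-48 V R)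
  , shift-by-48 V R
  , λ j → divides (+ 0) (ℤ.+-inverseʳ (derivative V j))

-- With divided differences W, S, U of orders one to three, seven shifts add 7a·7W + (7a)²·21S plus
-- a multiple of (7a)³. Dividing by 7·7a leaves W plus a multiple of 7, so the congruence with D V
-- survives.
lift : ∀ D N a .{{_ : NonZero a}} → Shift D N (+ 7 ℤ.* a) → Shift D (7 ℕ.* N) (+ 7 ℤ.* (+ 7 ℤ.* a))
lift D N a step V R with step V R
... | W , R-W , V-step , W≡D with step W R-W
... | S , R-S , W-step , _ with step S R-S
... | U , _ , S-step , _ =
  W′ , quotient-recurrent V W′ (7 ℕ.* N) (+ 7 ℤ.* (+ 7 ℤ.* a)) {{nonZero}} R V-step′ , V-step′ , W′≡D
  where
  nonZero : NonZero (+ 7 ℤ.* (+ 7 ℤ.* a))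
  nonZero = ℤ.i*j≢0 (+ 7) (+ 7 ℤ.* a) {{_}} {{ℤ.i*j≢0 (+ 7) a}}
  U-sum : ℕ → ℤ
  U-sum j = + 15 ℤ.* U (0 ℕ.* N + j) ℤ.+ + 10 ℤ.* U (1 ℕ.* N + j) ℤ.+ + 6 ℤ.* U (2 ℕ.* N + j)
    ℤ.+ + 3 ℤ.* U (3 ℕ.* N + j) ℤ.+ U (4 ℕ.* N + j)
  W′ : ℕ → ℤ
  W′ j = W j ℤ.+ + 7 ℤ.* (a ℤ.* (+ 3 ℤ.* S j ℤ.+ a ℤ.* U-sum j))
  along : ∀ F G → (∀ j → F (j + N) ≡ F j ℤ.+ + 7 ℤ.* a ℤ.* G j) →
    ∀ j i → F (suc i ℕ.* N + j) ≡ F (i ℕ.* N + j) ℤ.+ + 7 ℤ.* a ℤ.* G (i ℕ.* N + j)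
  along F G eq j i = trans (cong F (trans (ℕ.+-assoc N (i ℕ.* N) j) (ℕ.+-comm N (i ℕ.* N + j)))) (eq (i ℕ.* N + j))
  identity : ∀ a v w s u →
    v ℤ.+ + 7 ℤ.* a ℤ.* (+ 7 ℤ.* w ℤ.+ + 7 ℤ.* a ℤ.* (+ 21 ℤ.* s ℤ.+ + 7 ℤ.* a ℤ.* u))
    ≡ v ℤ.+ + 7 ℤ.* (+ 7 ℤ.* a) ℤ.* (w ℤ.+ + 7 ℤ.* (a ℤ.* (+ 3 ℤ.* s ℤ.+ a ℤ.* u)))
  identity = solve-∀
  V-step′ : ∀ j → V (j + 7 ℕ.* N) ≡ V j ℤ.+ + 7 ℤ.* (+ 7 ℤ.* a) ℤ.* W′ j
  V-step′ j = begin
    V (j + 7 ℕ.* N)                                  ≡⟨ cong V (ℕ.+-comm j (7 ℕ.* N)) ⟩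
    V (7 ℕ.* N + j)                                  ≡⟨ seventh-step (+ 7 ℤ.* a)
                                                          (λ i → V (i ℕ.* N + j)) (λ i → W (i ℕ.* N + j))
                                                          (λ i → S (i ℕ.* N + j)) (λ i → U (i ℕ.* N + j))
                                                          (along V W V-step j) (along W S W-step j) (along S U S-step j) ⟩
    _                                                ≡⟨ identity a (V j) (W j) (S j) (U-sum j) ⟩
    V j ℤ.+ + 7 ℤ.* (+ 7 ℤ.* a) ℤ.* W′ j             ∎
    where open ≡-Reasoning
  swap : ∀ w t d → w ℤ.- d ℤ.+ t ≡ w ℤ.+ t ℤ.- d
  swap = solve-∀
  W′≡D : ∀ j → + 7 ∣ W′ j ℤ.- D V j
  W′≡D j = subst (+ 7 ∣_) (swap (W j) _ (D V j))
    (∣m∣n⇒∣m+n (W≡D j) (∣m⇒∣m*n _ ∣-refl))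

-- This is 48·7^k, defined recursively to match the index `7 ℕ.* N` in `lift` by computation.
period : ℕ → ℕ
period zero    = 48
period (suc k) = 7 ℕ.* period k

-- The modulus 35·7^k has one factor 7 split off, which is the form that `lift` takes.
shift : ∀ k → Shift derivative (period k) (+ 7 ℤ.* + (5 ℕ.* 7 ^ k))
shift zero    = shift-48
shift (suc k) = subst (λ a → Shift derivative (period (suc k)) (+ 7 ℤ.* a)) eq
  (lift derivative (period k) (+ (5 ℕ.* 7 ^ k)) {{ℕ.m*n≢0 5 (7 ^ k) {{_}} {{ℕ.m^n≢0 7 k}}}} (shift k))
  where
  eq : + 7 ℤ.* + (5 ℕ.* 7 ^ k) ≡ + (5 ℕ.* 7 ^ suc k)
  eq = trans (sym (ℤ.pos-* 7 (5 ℕ.* 7 ^ k))) (cong +_ (x∙yz≈y∙xz 7 5 (7 ^ k)))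

-- A Taylor expansion in the number s of shifts: w is the slope at j, and t collects everything of
-- second order in a.
progression : ∀ D N a → Shift D N a → ∀ V → Recurrent V → ∀ s j →
  ∃[ w ] ∃[ t ] + 7 ∣ w ℤ.- D V j
    × V (j + s ℕ.* N) ≡ V j ℤ.+ a ℤ.* (w ℤ.* + s ℤ.+ a ℤ.* t)
progression D N a step V R s j with step V R
... | W , R-W , V-step , W≡D with step W R-W
... | S , _ , W-step , _ = W j , proj₁ (iterate s j) , W≡D j , proj₂ (iterate s j)
  where
  open ≡-Reasoning
  start : ∀ a v w → v ≡ v ℤ.+ a ℤ.* (w ℤ.* + 0 ℤ.+ a ℤ.* + 0)
  start = solve-∀
  next : ∀ a v w x y z → v ℤ.+ a ℤ.* w ℤ.+ a ℤ.* ((w ℤ.+ a ℤ.* x) ℤ.* y ℤ.+ a ℤ.* z)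
    ≡ v ℤ.+ a ℤ.* (w ℤ.* (+ 1 ℤ.+ y) ℤ.+ a ℤ.* (x ℤ.* y ℤ.+ z))
  next = solve-∀
  iterate : ∀ s j → ∃[ t ] V (j + s ℕ.* N) ≡ V j ℤ.+ a ℤ.* (W j ℤ.* + s ℤ.+ a ℤ.* t)
  iterate zero    j = + 0 , trans (cong V (ℕ.+-identityʳ j)) (start a (V j) (W j))
  iterate (suc s) j with iterate s (j + N)
  -- The slope at j + N exceeds the slope at j by a·S j, which over the remaining s shifts adds S
  -- j·s to the second-order term.
  ... | t , eq = S j ℤ.* + s ℤ.+ t , (begin
    V (j + (N + s ℕ.* N))                                            ≡⟨ cong V (sym (ℕ.+-assoc j N (s ℕ.* N))) ⟩
    V (j + N + s ℕ.* N)                                              ≡⟨ eq ⟩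
    V (j + N) ℤ.+ a ℤ.* (W (j + N) ℤ.* + s ℤ.+ a ℤ.* t)              ≡⟨ cong₂ (λ v w → v ℤ.+ a ℤ.* (w ℤ.* + s ℤ.+ a ℤ.* t)) (V-step j) (W-step j) ⟩
    _                                                                ≡⟨ next a (V j) (W j) (S j) (+ s) t ⟩
    _                                                                ∎)

-- Hensel lifting of the roots of P² = 1.

-- P₋₂₆ j is the Padovan number P_{j-26}; the shift makes all roots of P² = 1 have index in [0, 48).
P₋₂₆ : ℕ → ℤ
P₋₂₆ = run (+ 1) (+ 10) -[1+ 13 ]

P₋₂₆-recurrent : Recurrent P₋₂₆
P₋₂₆-recurrent = run-recurrent (+ 1) (+ 10) -[1+ 13 ]

P₋₂₆-padovan : ∀ m → P₋₂₆ (m + 26) ≡ + padovan m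
P₋₂₆-padovan 0 = refl
P₋₂₆-padovan 1 = refl
P₋₂₆-padovan 2 = refl
P₋₂₆-padovan (suc (suc (suc m))) = trans (P₋₂₆-recurrent (m + 26))
  (cong₂ ℤ._+_ (P₋₂₆-padovan (suc m)) (P₋₂₆-padovan m))

-- The root is exact in ℤ, not merely modular. Up to the factor 35·7^k, the second component
-- concerns the linear coefficient of P² - 1 along a progression of step 48·7^k.
SimpleRoot : ℕ → Set
SimpleRoot z = P₋₂₆ z ℤ.* P₋₂₆ z ≡ 1ℤ × ¬ + 7 ∣ + 2 ℤ.* P₋₂₆ z ℤ.* derivative P₋₂₆ z

-- Modulo 7 alone there is one spurious root, r = 47; the factor 5 excludes it.
roots-mod-35 : ∀ {r} → r ℕ.< 48 → + 35 ∣ P₋₂₆ r ℤ.* P₋₂₆ r ℤ.- 1ℤ → SimpleRoot r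
roots-mod-35 = from-yes (ℕ.allUpTo? (λ r →
  (+ 35 ∣? P₋₂₆ r ℤ.* P₋₂₆ r ℤ.- 1ℤ)
    →-dec ((P₋₂₆ r ℤ.* P₋₂₆ r ℤ.≟ 1ℤ) ×-dec ¬? (+ 7 ∣? + 2 ℤ.* P₋₂₆ r ℤ.* derivative P₋₂₆ r))) 48)

-- As q² = 1 exactly, the constant term of x² - 1 vanishes and x² - 1 = 7a(2qes + 7c). Cancelling 7a
-- leaves 7 dividing 2qe·s, and 7 is prime and does not divide 2qe.
root-digit : ∀ a .{{_ : NonZero a}} q w e s t x → q ℤ.* q ≡ 1ℤ → ¬ + 7 ∣ + 2 ℤ.* q ℤ.* e →
  + 7 ∣ w ℤ.- e → x ≡ q ℤ.+ + 7 ℤ.* a ℤ.* (w ℤ.* + s ℤ.+ + 7 ℤ.* a ℤ.* t) →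
  + 7 ℤ.* (+ 7 ℤ.* a) ∣ x ℤ.* x ℤ.- 1ℤ → 7 ℕ.∣ s
root-digit a q w e s t x q²≡1 simple (divides u w-e≡u*7) x-expansion dvd
  = [ (λ 7∣coefficient → contradiction (∣ᵤ⇒∣ 7∣coefficient) simple) , id ]′
    (euclidsLemma ∣ + 2 ℤ.* q ℤ.* e ∣ s (from-yes (prime? 7))
      (subst (7 ℕ.∣_) (ℤ.abs-* (+ 2 ℤ.* q ℤ.* e) (+ s)) (∣⇒∣ᵤ 7∣linear)))
  where
  open ≡-Reasoning
  y = w ℤ.* + s ℤ.+ + 7 ℤ.* a ℤ.* t
  -- The three summands come from w - e = 7u, from the second-order term t, and from the square of
  -- y.
  c = + 2 ℤ.* q ℤ.* u ℤ.* + s ℤ.+ + 2 ℤ.* q ℤ.* a ℤ.* t ℤ.+ a ℤ.* (y ℤ.* y)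
  w-expansion : w ≡ e ℤ.+ u ℤ.* + 7
  w-expansion = trans (identity w e) (cong (λ v → e ℤ.+ v) w-e≡u*7)
    where
    identity : ∀ w e → w ≡ e ℤ.+ (w ℤ.- e)
    identity = solve-∀
  square : ∀ q b y → (q ℤ.+ b ℤ.* y) ℤ.* (q ℤ.+ b ℤ.* y) ℤ.- 1ℤ
    ≡ (q ℤ.* q ℤ.- 1ℤ) ℤ.+ b ℤ.* (+ 2 ℤ.* q ℤ.* y ℤ.+ b ℤ.* (y ℤ.* y))
  square = solve-∀
  collect : ∀ a q e u s t z →
    + 2 ℤ.* q ℤ.* ((e ℤ.+ u ℤ.* + 7) ℤ.* s ℤ.+ + 7 ℤ.* a ℤ.* t) ℤ.+ + 7 ℤ.* a ℤ.* z
    ≡ + 2 ℤ.* q ℤ.* e ℤ.* s ℤ.+ + 7 ℤ.* (+ 2 ℤ.* q ℤ.* u ℤ.* s ℤ.+ + 2 ℤ.* q ℤ.* a ℤ.* t ℤ.+ a ℤ.* z)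
  collect = solve-∀
  expansion : x ℤ.* x ℤ.- 1ℤ ≡ + 7 ℤ.* a ℤ.* (+ 2 ℤ.* q ℤ.* e ℤ.* + s ℤ.+ + 7 ℤ.* c)
  expansion = begin
    x ℤ.* x ℤ.- 1ℤ
      ≡⟨ cong (λ v → v ℤ.* v ℤ.- 1ℤ) x-expansion ⟩
    (q ℤ.+ + 7 ℤ.* a ℤ.* y) ℤ.* (q ℤ.+ + 7 ℤ.* a ℤ.* y) ℤ.- 1ℤ
      ≡⟨ square q (+ 7 ℤ.* a) y ⟩
    (q ℤ.* q ℤ.- 1ℤ) ℤ.+ + 7 ℤ.* a ℤ.* (+ 2 ℤ.* q ℤ.* y ℤ.+ + 7 ℤ.* a ℤ.* (y ℤ.* y))
      ≡⟨ cong (λ v → (v ℤ.- 1ℤ) ℤ.+ + 7 ℤ.* a ℤ.* (+ 2 ℤ.* q ℤ.* y ℤ.+ + 7 ℤ.* a ℤ.* (y ℤ.* y))) q²≡1 ⟩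
    + 0 ℤ.+ + 7 ℤ.* a ℤ.* (+ 2 ℤ.* q ℤ.* y ℤ.+ + 7 ℤ.* a ℤ.* (y ℤ.* y))
      ≡⟨ ℤ.+-identityˡ _ ⟩
    + 7 ℤ.* a ℤ.* (+ 2 ℤ.* q ℤ.* y ℤ.+ + 7 ℤ.* a ℤ.* (y ℤ.* y))
      ≡⟨ cong (λ v → + 7 ℤ.* a ℤ.* (+ 2 ℤ.* q ℤ.* (v ℤ.* + s ℤ.+ + 7 ℤ.* a ℤ.* t) ℤ.+ + 7 ℤ.* a ℤ.* (y ℤ.* y))) w-expansion ⟩
    _ ≡⟨ cong (λ v → + 7 ℤ.* a ℤ.* v) (collect a q e u (+ s) t (y ℤ.* y)) ⟩
    _ ∎
  7∣linear : + 7 ∣ + 2 ℤ.* q ℤ.* e ℤ.* + s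
  7∣linear = ∣m+n∣n⇒∣m
    (*-cancelˡ-∣ (+ 7 ℤ.* a) {{ℤ.i*j≢0 (+ 7) a}}
      (subst₂ _∣_ (ℤ.*-comm (+ 7) (+ 7 ℤ.* a)) expansion dvd))
    (∣m⇒∣m*n c ∣-refl)

-- Since the root is exact, the same z serves at every level; each further factor 7 of the modulus
-- only forces 7 to divide s, and that factor is absorbed into the period.
hensel : ∀ k j → + (7 ℕ.* (5 ℕ.* 7 ^ k)) ∣ P₋₂₆ j ℤ.* P₋₂₆ j ℤ.- 1ℤ →
  ∃[ z ] ∃[ s ] SimpleRoot z × j ≡ z + s ℕ.* period k
hensel zero j dvd = r , s , roots-mod-35 (ℕ.m%n<n j 48) 35∣ , j≡r+s*48
  where
  r = j ℕ.% 48
  s = j ℕ./ 48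
  j≡r+s*48 : j ≡ r + s ℕ.* 48
  j≡r+s*48 = ℕ.m≡m%n+[m/n]*n j 48
  difference : ∀ b q y → (q ℤ.+ b ℤ.* y) ℤ.* (q ℤ.+ b ℤ.* y) ℤ.- 1ℤ ℤ.- b ℤ.* (y ℤ.* (+ 2 ℤ.* q ℤ.+ b ℤ.* y)) ≡ q ℤ.* q ℤ.- 1ℤ
  difference = solve-∀
  35∣ : + 35 ∣ P₋₂₆ r ℤ.* P₋₂₆ r ℤ.- 1ℤ
  35∣ =
    let w , t , _ , eq = progression derivative 48 (+ 35) shift-48 P₋₂₆ P₋₂₆-recurrent s r
        y = w ℤ.* + s ℤ.+ + 35 ℤ.* t
    in subst (+ 35 ∣_) (difference (+ 35) (P₋₂₆ r) y)
         (∣m∣n⇒∣m-n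
           (subst (λ v → + 35 ∣ v ℤ.* v ℤ.- 1ℤ) (trans (cong P₋₂₆ j≡r+s*48) eq) dvd)
           (∣m⇒∣m*n _ ∣-refl))
hensel (suc k) j dvd =
  -- The induction hypothesis needs the modulus with one factor 7 less; the full modulus is used for
  -- the next digit of s.
  let z , s , root , j≡z+s*N = hensel k j (∣-trans (∣ᵤ⇒∣ (ℕ.divides 7 modulus-suc)) dvd)
      w , t , w≡ , eq = progression derivative (period k) (+ 7 ℤ.* + a) (shift k) P₋₂₆ P₋₂₆-recurrent s z
      ℕ.divides s′ s≡s′*7 = root-digit (+ a) {{a≢0}} (P₋₂₆ z) w (derivative P₋₂₆ z) s t (P₋₂₆ j)
        (proj₁ root) (proj₂ root) w≡ (trans (cong P₋₂₆ j≡z+s*N) eq)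
        (subst (_∣ P₋₂₆ j ℤ.* P₋₂₆ j ℤ.- 1ℤ) modulus-suc-ℤ dvd)
  in z , s′ , root , trans j≡z+s*N (cong (z ℕ.+_) (trans (cong (ℕ._* period k) s≡s′*7) (ℕ.*-assoc s′ 7 (period k))))
  where
  a = 5 ℕ.* 7 ^ k
  a≢0 : ℕ.NonZero a
  a≢0 = ℕ.m*n≢0 5 (7 ^ k) {{_}} {{ℕ.m^n≢0 7 k}}
  modulus-suc : 7 ℕ.* (5 ℕ.* 7 ^ suc k) ≡ 7 ℕ.* (7 ℕ.* a)
  modulus-suc = cong (7 ℕ.*_) (x∙yz≈y∙xz 5 7 (7 ^ k))
  modulus-suc-ℤ : + (7 ℕ.* (5 ℕ.* 7 ^ suc k)) ≡ + 7 ℤ.* (+ 7 ℤ.* + a)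
  modulus-suc-ℤ = trans (cong +_ modulus-suc) (trans (ℤ.pos-* 7 (7 ℕ.* a)) (cong (+ 7 ℤ.*_) (ℤ.pos-* 7 a)))

-- Growth of the Padovan numbers.

padovan-step : ∀ m → padovan m ℕ.≤ padovan (suc m)
padovan-step 0 = ℕ.≤-refl
padovan-step 1 = ℕ.≤-refl
padovan-step 2 = ℕ.s≤s ℕ.z≤n
padovan-step (suc (suc (suc m))) = ℕ.+-mono-≤ (padovan-step (suc m)) (padovan-step m)

padovan-positive : ∀ m → 1 ℕ.≤ padovan m
padovan-positive zero    = ℕ.≤-refl
padovan-positive (suc m) = ℕ.≤-trans (padovan-positive m) (padovan-step m)

-- Three steps at least double the value, since P_{m+3} = P_{m+1} + P_m ≥ 2P_m.
2^i≤padovan[i*3+r] : ∀ i r → 2 ^ i ℕ.≤ padovan (i ℕ.* 3 + r)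
2^i≤padovan[i*3+r] zero    r = padovan-positive r
2^i≤padovan[i*3+r] (suc i) r = ℕ.+-mono-≤
  (ℕ.≤-trans (2^i≤padovan[i*3+r] i r) (padovan-step (i ℕ.* 3 + r)))
  (ℕ.≤-trans (ℕ.≤-reflexive (ℕ.+-identityʳ (2 ^ i))) (2^i≤padovan[i*3+r] i r))

4^i≤padovan² : ∀ i m → i ℕ.* 3 ℕ.≤ m → 4 ^ i ℕ.≤ padovan m ^ 2
4^i≤padovan² i m i*3≤m = begin
  (2 ^ 2) ^ i      ≡⟨ ℕ.^-*-assoc 2 2 i ⟩
  2 ^ (2 ℕ.* i)    ≡⟨ cong (2 ^_) (ℕ.*-comm 2 i) ⟩
  2 ^ (i ℕ.* 2)    ≡⟨ sym (ℕ.^-*-assoc 2 i 2) ⟩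
  (2 ^ i) ^ 2      ≤⟨ ℕ.^-monoˡ-≤ 2 (2^i≤padovan[i*3+r] i (m ℕ.∸ i ℕ.* 3)) ⟩
  padovan (i ℕ.* 3 + (m ℕ.∸ i ℕ.* 3)) ^ 2
                   ≡⟨ cong (λ n → padovan n ^ 2) (ℕ.m+[n∸m]≡n i*3≤m) ⟩
  padovan m ^ 2    ∎
  where open ℕ.≤-Reasoning

-- Size and 7-divisibility of factorials, compared with the period.

!-mono-≤ : ∀ {m n} → m ℕ.≤ n → m ! ℕ.≤ n !
!-mono-≤ {n = n} m≤n = ℕ.∣⇒≤ {{n ℕ.!≢0}} (ℕ.m≤n⇒m!∣n! m≤n)

[i+n]!≤[i+n]^i*n! : ∀ i n → (i + n) ! ℕ.≤ (i + n) ^ i ℕ.* n !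
[i+n]!≤[i+n]^i*n! zero    n = ℕ.m≤m+n (n !) 0
[i+n]!≤[i+n]^i*n! (suc i) n = begin
  suc (i + n) ℕ.* (i + n) !                        ≤⟨ ℕ.*-monoʳ-≤ (suc (i + n)) ([i+n]!≤[i+n]^i*n! i n) ⟩
  suc (i + n) ℕ.* ((i + n) ^ i ℕ.* n !)            ≤⟨ ℕ.*-monoʳ-≤ (suc (i + n)) (ℕ.*-monoˡ-≤ (n !) (ℕ.^-monoˡ-≤ i (ℕ.n≤1+n (i + n)))) ⟩
  suc (i + n) ℕ.* (suc (i + n) ^ i ℕ.* n !)        ≡⟨ sym (ℕ.*-assoc (suc (i + n)) (suc (i + n) ^ i) (n !)) ⟩
  suc (i + n) ^ suc i ℕ.* n !                      ∎
  where open ℕ.≤-Reasoning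

n≤2^n : ∀ n → n ℕ.≤ 2 ^ n
n≤2^n zero    = ℕ.z≤n
n≤2^n (suc n) = ℕ.+-mono-≤ (ℕ.m^n>0 2 n) (ℕ.≤-trans (n≤2^n n) (ℕ.m≤m+n (2 ^ n) 0))

4+k≤7^[1+k] : ∀ k → 4 + k ℕ.≤ 7 ^ (1 + k)
4+k≤7^[1+k] zero    = from-yes (4 ℕ.≤? 7)
4+k≤7^[1+k] (suc k) = ℕ.+-mono-≤ (ℕ.m^n>0 7 (1 + k))
  (ℕ.≤-trans (4+k≤7^[1+k] k) (ℕ.m≤m+n (7 ^ (1 + k)) (5 ℕ.* 7 ^ (1 + k))))

-- From k to k + 1 the left side grows by a factor of at most (7 + M)^7, the right side by 4^(6e),
-- and 7 + M ≤ e ≤ 2^e.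
factorial-bound : ∀ k → 2 ℕ.* (7 ℕ.* (3 + k)) ! ℕ.< 4 ^ (7 ^ (2 + k))
factorial-bound zero    = from-yes (2 ℕ.* 21 ! ℕ.<? 4 ^ 49)
factorial-bound (suc k) = begin-strict
  2 ℕ.* (7 ℕ.* (4 + k)) !                   ≡⟨ cong (λ n → 2 ℕ.* n !) (ℕ.*-suc 7 (3 + k)) ⟩
  2 ℕ.* (7 + M) !                           ≤⟨ ℕ.*-monoʳ-≤ 2 ([i+n]!≤[i+n]^i*n! 7 M) ⟩
  2 ℕ.* ((7 + M) ^ 7 ℕ.* M !)               ≡⟨ x∙yz≈y∙xz 2 ((7 + M) ^ 7) (M !) ⟩
  (7 + M) ^ 7 ℕ.* (2 ℕ.* M !)               <⟨ ℕ.*-monoʳ-< ((7 + M) ^ 7) {{ℕ.m^n≢0 (7 + M) 7}} (factorial-bound k) ⟩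
  (7 + M) ^ 7 ℕ.* 4 ^ e                     ≤⟨ ℕ.*-monoˡ-≤ (4 ^ e) power-bound ⟩
  4 ^ (6 ℕ.* e) ℕ.* 4 ^ e                   ≡⟨ ℕ.*-comm (4 ^ (6 ℕ.* e)) (4 ^ e) ⟩
  4 ^ e ℕ.* 4 ^ (6 ℕ.* e)                   ≡⟨ sym (ℕ.^-distribˡ-+-* 4 e (6 ℕ.* e)) ⟩
  4 ^ (7 ^ (3 + k))                         ∎
  where
  open ℕ.≤-Reasoning
  M = 7 ℕ.* (3 + k)
  e = 7 ^ (2 + k)
  7+M≤e : 7 + M ℕ.≤ e
  7+M≤e = begin
    7 + M          ≡⟨ sym (ℕ.*-suc 7 (3 + k)) ⟩
    7 ℕ.* (4 + k)  ≤⟨ ℕ.*-monoʳ-≤ 7 (4+k≤7^[1+k] k) ⟩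
    e              ∎
  power-bound : (7 + M) ^ 7 ℕ.≤ 4 ^ (6 ℕ.* e)
  power-bound = begin
    (7 + M) ^ 7              ≤⟨ ℕ.^-monoˡ-≤ 7 (ℕ.≤-trans 7+M≤e (n≤2^n e)) ⟩
    (2 ^ e) ^ 7              ≡⟨ ℕ.^-*-assoc 2 e 7 ⟩
    -- The exponent 12 is chosen because 4^(6e) = 2^(12e).
    2 ^ (e ℕ.* 7)            ≤⟨ ℕ.^-monoʳ-≤ 2 (ℕ.*-monoʳ-≤ e (from-yes (7 ℕ.≤? 12))) ⟩
    2 ^ (e ℕ.* 12)           ≡⟨ cong (2 ^_) (trans (ℕ.*-comm e 12) (ℕ.*-assoc 2 6 e)) ⟩
    2 ^ (2 ℕ.* (6 ℕ.* e))    ≡⟨ sym (ℕ.^-*-assoc 2 2 (6 ℕ.* e)) ⟩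
    4 ^ (6 ℕ.* e)            ∎

-- 7! supplies 5·7, and each further block of seven factors ends in a multiple of 7.
35*7^k∣[7+7k]! : ∀ k → 7 ℕ.* (5 ℕ.* 7 ^ k) ℕ.∣ (7 ℕ.* suc k) !
35*7^k∣[7+7k]! zero    = from-yes (35 ℕ.∣? 7 !)
35*7^k∣[7+7k]! (suc k) = subst₂ ℕ._∣_
  (cong (7 ℕ.*_) (x∙yz≈y∙xz 7 5 (7 ^ k))) (cong _! (sym (ℕ.*-suc 7 (suc k))))
  (ℕ.*-pres-∣ {7} {7 + 7 ℕ.* suc k} {7 ℕ.* (5 ℕ.* 7 ^ k)} {(6 + 7 ℕ.* suc k) !}
    (ℕ.∣m∣n⇒∣m+n ℕ.∣-refl (ℕ.m∣m*n (suc k)))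
    (ℕ.∣-trans (35*7^k∣[7+7k]! k) (ℕ.m≤n⇒m!∣n! (ℕ.m≤n+m (7 ℕ.* suc k) 6))))

-- An index m + 26 beyond the period thus has m ≥ 3·7^(2+k), so P_m² ≥ 4^(7^(2+k)), the right side
-- of `factorial-bound`. The 26 undoes the index shift.
period-bound : ∀ k → 7 ^ (2 + k) ℕ.* 3 + 26 ℕ.≤ period (suc k)
period-bound zero    = from-yes (173 ℕ.≤? 336)
period-bound (suc k) = begin
  7 ^ (3 + k) ℕ.* 3 + 26                ≤⟨ ℕ.+-monoʳ-≤ (7 ^ (3 + k) ℕ.* 3) (from-yes (26 ℕ.≤? 182)) ⟩
  7 ℕ.* e ℕ.* 3 + 7 ℕ.* 26              ≡⟨ cong (_+ 7 ℕ.* 26) (ℕ.*-assoc 7 e 3) ⟩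
  7 ℕ.* (e ℕ.* 3) + 7 ℕ.* 26            ≡⟨ sym (ℕ.*-distribˡ-+ 7 (e ℕ.* 3) 26) ⟩
  7 ℕ.* (e ℕ.* 3 + 26)                  ≤⟨ ℕ.*-monoʳ-≤ 7 (period-bound k) ⟩
  period (2 + k)                        ∎
  where
  open ℕ.≤-Reasoning
  e = 7 ^ (2 + k)

-- Solving n! + 1 = P_m².

brocard-ℤ : ∀ n m → n ! + 1 ≡ padovan m ^ 2 → P₋₂₆ (m + 26) ℤ.* P₋₂₆ (m + 26) ℤ.- 1ℤ ≡ + (n !)
brocard-ℤ n m eq = begin
  P₋₂₆ (m + 26) ℤ.* P₋₂₆ (m + 26) ℤ.- 1ℤ    ≡⟨ cong (λ v → v ℤ.* v ℤ.- 1ℤ) (P₋₂₆-padovan m) ⟩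
  + padovan m ℤ.* + padovan m ℤ.- 1ℤ        ≡⟨ cong (ℤ._- 1ℤ) (sym (ℤ.pos-* (padovan m) (padovan m))) ⟩
  + (padovan m ℕ.* padovan m) ℤ.- 1ℤ        ≡⟨ cong (λ v → + v ℤ.- 1ℤ) (trans (cong (padovan m ℕ.*_) (sym (ℕ.*-identityʳ (padovan m)))) (sym eq)) ⟩
  + (n ! + 1) ℤ.- 1ℤ                        ≡⟨ cancel (+ (n !)) ⟩
  + (n !)                                   ∎
  where
  open ≡-Reasoning
  cancel : ∀ x → x ℤ.+ 1ℤ ℤ.- 1ℤ ≡ x
  cancel = solve-∀

-- Here 2 + k is the quotient of n by 7, so 35·7^(1+k) divides n! and `hensel` applies at level 1 +
-- k; both the case s = 0 and the case s > 0 are contradictory.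
no-large-solution : ∀ k r m → r ℕ.< 7 → (r + (2 + k) ℕ.* 7) ! + 1 ≢ padovan m ^ 2
no-large-solution k r m r<7 eq = impossible (hensel (suc k) (m + 26)
  (subst (+ (7 ℕ.* (5 ℕ.* 7 ^ suc k)) ∣_) (sym (brocard-ℤ n m eq))
    (∣ᵤ⇒∣ (ℕ.∣-trans (35*7^k∣[7+7k]! (suc k)) (ℕ.m≤n⇒m!∣n! n-lower)))))
  where
  open ℕ.≤-Reasoning
  n = r + (2 + k) ℕ.* 7
  n-lower : 7 ℕ.* (2 + k) ℕ.≤ n
  n-lower = begin
    7 ℕ.* (2 + k)  ≡⟨ ℕ.*-comm 7 (2 + k) ⟩
    (2 + k) ℕ.* 7  ≤⟨ ℕ.m≤n+m ((2 + k) ℕ.* 7) r ⟩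
    n              ∎
  n-upper : n ℕ.≤ 7 ℕ.* (3 + k)
  n-upper = begin
    n              ≤⟨ ℕ.+-monoˡ-≤ ((2 + k) ℕ.* 7) (ℕ.<⇒≤ r<7) ⟩
    (3 + k) ℕ.* 7  ≡⟨ ℕ.*-comm (3 + k) 7 ⟩
    7 ℕ.* (3 + k)  ∎
  m-small : ¬ period (suc k) ℕ.≤ m + 26
  m-small N≤m+26 = ℕ.<-irrefl refl (begin-strict
    4 ^ (7 ^ (2 + k))          ≤⟨ 4^i≤padovan² (7 ^ (2 + k)) m (ℕ.+-cancelʳ-≤ 26 _ m (ℕ.≤-trans (period-bound k) N≤m+26)) ⟩
    padovan m ^ 2              ≡⟨ sym eq ⟩
    n ! + 1                    ≤⟨ ℕ.+-monoʳ-≤ (n !) (ℕ.≤-trans (ℕ.1≤n! n) (ℕ.m≤m+n (n !) 0)) ⟩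
    2 ℕ.* n !                  ≤⟨ ℕ.*-monoʳ-≤ 2 (!-mono-≤ n-upper) ⟩
    2 ℕ.* (7 ℕ.* (3 + k)) !    <⟨ factorial-bound k ⟩
    4 ^ (7 ^ (2 + k))          ∎)
  impossible : ¬ (∃[ z ] ∃[ s ] SimpleRoot z × m + 26 ≡ z + s ℕ.* period (suc k))
  -- With s = 0 the index is an exact root, so n! = P_m² - 1 = 0.
  impossible (z , zero , root , m+26≡z+0) = ℕ.≢-nonZero⁻¹ (n !) {{n ℕ.!≢0}}
    (ℤ.+-injective (trans (sym (brocard-ℤ n m eq))
      (trans (cong (λ j → P₋₂₆ j ℤ.* P₋₂₆ j ℤ.- 1ℤ) (trans m+26≡z+0 (ℕ.+-identityʳ z)))
        (cong (ℤ._- 1ℤ) (proj₁ root)))))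
  impossible (z , suc s , _ , m+26≡) = m-small (begin
    period (suc k)                              ≤⟨ ℕ.m≤m+n (period (suc k)) (s ℕ.* period (suc k)) ⟩
    suc s ℕ.* period (suc k)                    ≤⟨ ℕ.m≤n+m (suc s ℕ.* period (suc k)) z ⟩
    z + suc s ℕ.* period (suc k)                ≡⟨ sym m+26≡ ⟩
    m + 26                                      ∎)

-- A finite search, run on `P₋₂₆` because `padovan` itself branches. The bound 14 is the least n
-- with n/7 ≥ 2, and 51 = 3·17 is where P_m² ≥ 4^17 > 13! + 1 sets in.
small-solutions : ∀ {n} → n ℕ.< 14 → ∀ {m} → m ℕ.< 51 →
  P₋₂₆ (m + 26) ℤ.* P₋₂₆ (m + 26) ℤ.- 1ℤ ≡ + (n !) → n ≡ 4 × P₋₂₆ (m + 26) ≡ + 5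
small-solutions = from-yes (ℕ.allUpTo? (λ n → ℕ.allUpTo? (λ m →
  (P₋₂₆ (m + 26) ℤ.* P₋₂₆ (m + 26) ℤ.- 1ℤ ℤ.≟ + (n !))
    →-dec ((n ℕ.≟ 4) ×-dec (P₋₂₆ (m + 26) ℤ.≟ + 5))) 51) 14)

solution-unique : ∀ n m → n ! + 1 ≡ padovan m ^ 2 → n ≡ 4 × padovan m ≡ 5
solution-unique n m eq with n ℕ.<? 14 | m ℕ.<? 51
... | yes n<14 | yes m<51 =
  let n≡4 , P≡5 = small-solutions n<14 m<51 (brocard-ℤ n m eq)
  in n≡4 , ℤ.+-injective (trans (sym (P₋₂₆-padovan m)) P≡5)
... | yes n<14 | no m≮51 = contradiction
  (begin
    4 ^ 17           ≤⟨ 4^i≤padovan² 17 m (ℕ.≮⇒≥ m≮51) ⟩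
    padovan m ^ 2    ≡⟨ sym eq ⟩
    n ! + 1          ≤⟨ ℕ.+-monoˡ-≤ 1 (!-mono-≤ (ℕ.s≤s⁻¹ n<14)) ⟩
    13 ! + 1         ∎)
  (ℕ.<⇒≱ (from-yes (13 ! + 1 ℕ.<? 4 ^ 17)))
  where open ℕ.≤-Reasoning
... | no n≮14 | _ = contradiction
  (subst (λ n → n ! + 1 ≡ padovan m ^ 2) n≡r+[2+k]*7 eq)
  (no-large-solution (n ℕ./ 7 ℕ.∸ 2) (n ℕ.% 7) m (ℕ.m%n<n n 7))
  where
  -- The truncated subtraction is exact, since n ≥ 14 makes the quotient at least 2.
  n≡r+[2+k]*7 : n ≡ n ℕ.% 7 + (2 + (n ℕ./ 7 ℕ.∸ 2)) ℕ.* 7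
  n≡r+[2+k]*7 = trans (ℕ.m≡m%n+[m/n]*n n 7)
    (cong (λ q → n ℕ.% 7 + q ℕ.* 7) (sym (ℕ.m+[n∸m]≡n (ℕ./-monoˡ-≤ 7 (ℕ.≮⇒≥ n≮14)))))

theorem1 : (n x : ℕ) → (IsPadovan x × n ! + 1 ≡ x ^ 2) ⇔ ((n , x) ≡ (4 , 5))
theorem1 n x = mk⇔ only-if if
  where
  only-if : IsPadovan x × n ! + 1 ≡ x ^ 2 → (n , x) ≡ (4 , 5)
  only-if ((m , x≡Pm) , eq) =
    let n≡4 , Pm≡5 = solution-unique n m (trans eq (cong (_^ 2) x≡Pm))
    in cong₂ _,_ n≡4 (trans x≡Pm Pm≡5)
  if : (n , x) ≡ (4 , 5) → IsPadovan x × n ! + 1 ≡ x ^ 2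
  -- The witness is the index in P_7 = 5.
  if refl = (7 , refl) , refl
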